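{- Let $s\ge0$ be an integer, $h\in\mathbb C\setminus\{0\}$ and $q\in\mathbb C\setminus\{0\}$. Then $$S_{s,h,q}[n,k]=\sum_{j=k}^nh^{n-j}q^{s(j-1)-(s-1)(k-1)}S_{s,h,q}[j-1,k-1]\prod_{i=j}^{n-1}[si-(s-1)k]_q\qquad(1\le k\le n),$$ $$S_{s,h,q}[n,k]=\sum_{j=k}^n(-h)^{j-k}q^{sn(k-j-1)+(s-1)\binom{j+1}2-(s-1)\binom k2}S_{s,h,q}[n+1,j+1]\prod_{i=k+1}^j[sn-(s-1)i]_q\qquad(0\le k\le n),$$ $$S_{s,h,q}[n,k]=\sum_{j=0}^kh\,q^{j(sn-(s-1)k)-\binom{j+1}2}[s(n-j-1)-(s-1)(k-j)]_q\,S_{s,h,q}[n-j-1,k-j]\qquad(0\le k<n).$$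
   Context: For an integer $x$, $[x]_q=\frac{q^x-1}{q-1}$ if $q\ne1$ and $[x]_1=x$. The numbers $S_{s,h,q}[n,k]$ are the coefficients in $(VU)^n=\sum_{k=0}^nS_{s,h,q}[n,k]V^{sn-(s-1)k}U^k$, where $UV-qVU=hV^s$; equivalently they are determined by $S_{s,h,q}[n,k]=q^{s(n-1)-(s-1)(k-1)}S_{s,h,q}[n-1,k-1]+h[s(n-1)-(s-1)k]_q\,S_{s,h,q}[n-1,k]$ for $n,k\ge1$, with $S_{s,h,q}[n,0]=S_{s,h,q}[0,n]=\delta_{0,n}$. Empty products equal $1$. -}

module Defs where

open import Algebra.Apartness.Bundles using (HeytingField; HeytingCommutativeRing)
open import Algebra.Bundles using (CommutativeRing; Semiring)
open import Algebra.Bundles.Raw using (RawMonoid; RawSemiring)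
import Algebra.Definitions.RawMonoid as RawMonoidDefinitions
import Algebra.Definitions.RawSemiring as RawSemiringDefinitions
open import Data.Fin.Base using (toℕ)
open import Data.Integer.Base using (ℤ; +_; -[1+_])
open import Data.Nat.Base as ℕ using (ℕ; suc; _∸_)
open import Data.Product.Base using (proj₁)
open import Level using (_⊔_)
open import Relation.Binary.PropositionalEquality.Core using (_≡_)
open import Relation.Nullary.Decidable.Core using (Dec; yes; no)

-- f m ∙ f (m + 1) ∙ … ∙ f n, both bounds included; it is ε when n < m.
bigOp : ∀ {a ℓ} (M : RawMonoid a ℓ) → let open RawMonoid M in
        ℕ → ℕ → (ℕ → Carrier) → Carrier
bigOp M m n f = RawMonoidDefinitions.sum M {suc n ∸ m} λ i → f (m ℕ.+ toℕ i)

module FieldOps {c ℓ₁ ℓ₂} (F : HeytingField c ℓ₁ ℓ₂) where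

  open HeytingField F public using (Carrier; _≈_; _#_; _*_; -_; 0#; 1#)
  open HeytingField F using (_-_; #⇒invertible; heytingCommutativeRing)
  open HeytingCommutativeRing heytingCommutativeRing using (commutativeRing)
  open CommutativeRing commutativeRing using (semiring)
  open Semiring semiring using (rawSemiring; +-rawMonoid; *-rawMonoid)

  open RawSemiringDefinitions rawSemiring public using (_^_)
  open RawSemiringDefinitions rawSemiring using (_×_)

  ∑ ∏ : ℕ → ℕ → (ℕ → Carrier) → Carrier
  ∑ = bigOp +-rawMonoid
  ∏ = bigOp *-rawMonoid

  infix 5 ∑ ∏
  syntax ∑ m n (λ j → x) = ∑[ j ∈ m ⋯ n ] x
  syntax ∏ m n (λ j → x) = ∏[ j ∈ m ⋯ n ] x

  fromℤ : ℤ → Carrier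
  fromℤ (+ n)    = n × 1#
  fromℤ -[1+ n ] = - (suc n × 1#)

  module _ (q : Carrier) (q#0 : q # 0#) where

    -- `#⇒invertible q#0` inverts `q - 0#`, which is `q`.
    zpow : ℤ → Carrier
    zpow (+ n)    = q ^ n
    zpow -[1+ n ] = proj₁ (#⇒invertible q#0) ^ suc n

    -- (q ^ x - 1) / (q - 1) if q ≠ 1, and x if q = 1.  By tightness of the
    -- apartness relation, `¬ (q # 1#)` is the same as `q ≈ 1#`.
    qNumber : Dec (q # 1#) → ℤ → Carrier
    qNumber (yes q#1) x = (zpow x - 1#) * proj₁ (#⇒invertible q#1)
    qNumber (no  _)   x = fromℤ x

-- The unital associative algebra over F generated by U and V, subject to the
-- single relation UV - qVU = hV^s: noncommutative polynomial expressions,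
-- modulo the congruence _≋_.
module NormalOrdering {c ℓ₁ ℓ₂} (F : HeytingField c ℓ₁ ℓ₂) (s : ℕ)
                      (h q : HeytingField.Carrier F) where

  open HeytingField F using (Carrier; _≈_; _+_; _*_; 0#; 1#)

  infixl 7 _⊗_
  infixl 6 _⊕_
  infix  8 ⊝_

  data Expr : Set c where
    const   : Carrier → Expr
    U V     : Expr
    _⊕_ _⊗_ : Expr → Expr → Expr
    ⊝_      : Expr → Expr

  -- The equality field plays no role in the operations taken from it below.
  rawSemiring : RawSemiring c c
  rawSemiring = record
    { _≈_ = _≡_ ; _+_ = _⊕_ ; _*_ = _⊗_ ; 0# = const 0# ; 1# = const 1# }

  open RawSemiringDefinitions rawSemiring public using (_^_)

  infix 4 _≋_

  data _≋_ : Expr → Expr → Set (c ⊔ ℓ₁) where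
    ≋-refl  : ∀ {x} → x ≋ x
    ≋-sym   : ∀ {x y} → x ≋ y → y ≋ x
    ≋-trans : ∀ {x y z} → x ≋ y → y ≋ z → x ≋ z

    ⊕-cong : ∀ {x x′ y y′} → x ≋ x′ → y ≋ y′ → x ⊕ y ≋ x′ ⊕ y′
    ⊗-cong : ∀ {x x′ y y′} → x ≋ x′ → y ≋ y′ → x ⊗ y ≋ x′ ⊗ y′
    ⊝-cong : ∀ {x x′} → x ≋ x′ → ⊝ x ≋ ⊝ x′

    ⊕-assoc     : ∀ x y z → (x ⊕ y) ⊕ z ≋ x ⊕ (y ⊕ z)
    ⊕-comm      : ∀ x y → x ⊕ y ≋ y ⊕ x
    ⊕-identityˡ : ∀ x → const 0# ⊕ x ≋ x
    ⊝-inverseˡ  : ∀ x → ⊝ x ⊕ x ≋ const 0#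

    ⊗-assoc     : ∀ x y z → (x ⊗ y) ⊗ z ≋ x ⊗ (y ⊗ z)
    ⊗-identityˡ : ∀ x → const 1# ⊗ x ≋ x
    ⊗-identityʳ : ∀ x → x ⊗ const 1# ≋ x
    ⊗-distribˡ  : ∀ x y z → x ⊗ (y ⊕ z) ≋ (x ⊗ y) ⊕ (x ⊗ z)
    ⊗-distribʳ  : ∀ x y z → (y ⊕ z) ⊗ x ≋ (y ⊗ x) ⊕ (z ⊗ x)

    const-cong    : ∀ {a b} → a ≈ b → const a ≋ const b
    const-+       : ∀ a b → const (a + b) ≋ const a ⊕ const b
    const-*       : ∀ a b → const (a * b) ≋ const a ⊗ const b
    const-central : ∀ a x → const a ⊗ x ≋ x ⊗ const a

    relation : U ⊗ V ⊕ ⊝ (const q ⊗ (V ⊗ U)) ≋ const h ⊗ V ^ s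

  -- The exponent of V in the k-th term is written s (n - k) + k, which equals
  -- s n - (s - 1) k for k ≤ n.  Values S n k with n < k are not constrained.
  IsNormalOrdering : (ℕ → ℕ → Carrier) → Set (c ⊔ ℓ₁)
  IsNormalOrdering S = ∀ n →
    (V ⊗ U) ^ n ≋
    bigOp (RawSemiring.+-rawMonoid rawSemiring) 0 n
      (λ k → const (S n k) ⊗ (V ^ (s ℕ.* (n ∸ k) ℕ.+ k) ⊗ U ^ k))

-- The monomials V^i U^j are separated by an action of the algebra on functionals on
-- their span, so the coefficients of (VU)^n are unique; comparing the two sides of
-- (VU)^(n+1) = VU (VU)^n yields the recurrence for S.  The first sum unfolds the second
-- term of the recurrence, the third sum unfolds the first term, and the second sum
-- unfolds the recurrence solved for S n k.
module Submission where

open import Defs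
open import Algebra.Apartness.Bundles using (HeytingField; HeytingCommutativeRing)
open import Algebra.Bundles using (CommutativeRing; Monoid)
open import Algebra.Bundles.Raw using (RawSemiring)
open import Data.Fin.Base using (toℕ)
open import Data.Fin.Properties using (toℕ<n; toℕ-inject₁; toℕ-fromℕ)
open import Data.Integer.Base using (ℤ; +_; -[1+_]; 1ℤ; -1ℤ)
  renaming (_+_ to _+ᶻ_; _-_ to _-ᶻ_; _*_ to _*ᶻ_; -_ to -ᶻ_)
import Data.Integer.Properties as ℤ
import Data.Integer.Tactic.RingSolver as ℤ
open import Data.Nat.Base as ℕ using (ℕ; zero; suc; _∸_; _≤_; _<_; z≤n; s≤s)
open import Data.Nat.Combinatorics using (_C_; nCk+nC[k+1]≡[n+1]C[k+1]; nC1≡n)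
import Data.Nat.Properties as ℕ
open import Data.Product.Base using (_×_; _,_; proj₁; proj₂)
open import Data.Sum.Base using (inj₁; inj₂)
open import Function.Base using (_∘_)
open import Relation.Binary.PropositionalEquality as ≡ using (_≡_)
open import Relation.Nullary.Decidable.Core using (Dec; yes; no)

-- Sums and products over an interval in a monoid.

module BigOp {a ℓ} (M : Monoid a ℓ) where

  open Monoid M
  open import Algebra.Properties.Monoid.Sum M using (sum-cong-≋; sum-init-last)

  private
    ⨁ : ℕ → ℕ → (ℕ → Carrier) → Carrier
    ⨁ = bigOp rawMonoid

    index-bound : ∀ m n i → i < suc n ∸ m → m ℕ.+ i ≤ n
    index-bound zero    n       i i<          = ℕ.≤-pred i<
    -- `1 ∸ suc m` is 0, so the range holds no index at all.
    index-bound (suc m) zero    i i< rewrite ℕ.0∸n≡0 m with () ← i<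
    index-bound (suc m) (suc n) i i<          = s≤s (index-bound m n i i<)

  bigOp-cong : ∀ m n {f g : ℕ → Carrier} →
               (∀ j → m ≤ j → j ≤ n → f j ≈ g j) → ⨁ m n f ≈ ⨁ m n g
  bigOp-cong m n f≈g = sum-cong-≋ λ i →
    f≈g _ (ℕ.m≤m+n m _) (index-bound m n (toℕ i) (toℕ<n i))

  bigOp-empty : ∀ {m n} (f : ℕ → Carrier) → n < m → ⨁ m n f ≈ ε
  bigOp-empty f n<m rewrite ℕ.m≤n⇒m∸n≡0 n<m = refl

  bigOp-head : ∀ {m n} (f : ℕ → Carrier) → m ≤ n →
               ⨁ m n f ≈ f m ∙ ⨁ (suc m) n f
  bigOp-head {m} {n} f m≤n rewrite ℕ.+-∸-assoc 1 m≤n = ∙-cong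
    (reflexive (≡.cong f (ℕ.+-identityʳ m)))
    (sum-cong-≋ {n ∸ m} λ i → reflexive (≡.cong f (ℕ.+-suc m (toℕ i))))

  -- The bound admits `m = suc n`, where the front part is empty; the base case of
  -- `column-expansion` splits its one-term sum in this way.
  bigOp-last : ∀ {m n} (f : ℕ → Carrier) → m ≤ suc n →
               ⨁ m (suc n) f ≈ ⨁ m n f ∙ f (suc n)
  bigOp-last {m} {n} f m≤1+n rewrite ℕ.+-∸-assoc 1 m≤1+n = trans
    (sum-init-last {suc n ∸ m} λ i → f (m ℕ.+ toℕ i))
    (∙-cong
      (sum-cong-≋ {suc n ∸ m} λ i →
        reflexive (≡.cong (λ l → f (m ℕ.+ l)) (toℕ-inject₁ i)))
      (reflexive (≡.cong f (≡.trans
        (≡.cong (m ℕ.+_) (toℕ-fromℕ (suc n ∸ m)))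
        (ℕ.m+[n∸m]≡n m≤1+n)))))

-- Field arithmetic, integer powers and q-numbers.

module FieldProperties {c ℓ₁ ℓ₂} (F : HeytingField c ℓ₁ ℓ₂) where

  open HeytingField F using (heytingCommutativeRing; #⇒invertible; tight)
  open HeytingCommutativeRing heytingCommutativeRing using (commutativeRing)
  open CommutativeRing commutativeRing public
    using ( _+_; _-_; refl; sym; trans; reflexive; setoid; ring; semiring
          ; commutativeSemiring; +-monoid; *-monoid; +-cong; +-congˡ; +-congʳ; *-cong
          ; *-congˡ; *-congʳ; *-assoc; *-comm; *-identityˡ; *-identityʳ
          ; +-identityˡ; +-identityʳ; +-assoc; +-comm; distribˡ; distribʳ
          ; zeroˡ; zeroʳ; -‿cong; -‿inverseˡ; -‿inverseʳ )
  open FieldOps F public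
  open import Algebra.Properties.Ring ring public
    using (-‿distribʳ-*; -0#≈0#; -‿+-comm)
  open import Algebra.Properties.Semiring.Sum semiring using (*-distribˡ-sum; ∑-distrib-+)
  open import Algebra.Solver.Ring.NaturalCoefficients.Default commutativeSemiring public
    using (solve; _:=_; _:+_; _:*_; con)
  open import Relation.Binary.Reasoning.Setoid setoid

  open BigOp +-monoid public using () renaming
    (bigOp-cong to ∑-cong; bigOp-empty to ∑-empty; bigOp-head to ∑-head; bigOp-last to ∑-last)
  open BigOp *-monoid public using () renaming
    (bigOp-empty to ∏-empty; bigOp-head to ∏-head; bigOp-last to ∏-last)

  *-distribˡ-∑ : ∀ m n x (f : ℕ → Carrier) →
                 x * (∑[ j ∈ m ⋯ n ] f j) ≈ ∑[ j ∈ m ⋯ n ] x * f j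
  *-distribˡ-∑ m n x f = *-distribˡ-sum {suc n ∸ m} x (λ i → f (m ℕ.+ toℕ i))

  ∑-homo-+ : ∀ m n (f g : ℕ → Carrier) →
             ∑[ k ∈ m ⋯ n ] (f k + g k) ≈ (∑ m n f) + (∑ m n g)
  ∑-homo-+ m n f g = ∑-distrib-+ {suc n ∸ m} (λ i → f (m ℕ.+ toℕ i)) (λ i → g (m ℕ.+ toℕ i))

  module Powers (q : Carrier) (q#0 : q # 0#) where

    q^ : ℤ → Carrier
    q^ = zpow q q#0

    q⁻¹ : Carrier
    q⁻¹ = proj₁ (#⇒invertible q#0)

    q*q⁻¹≈1 : q * q⁻¹ ≈ 1#
    q*q⁻¹≈1 = begin
      q * q⁻¹         ≈⟨ *-congʳ (trans (+-congˡ -0#≈0#) (+-identityʳ q)) ⟨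
      (q - 0#) * q⁻¹  ≈⟨ proj₂ (proj₂ (#⇒invertible q#0)) ⟩
      1#              ∎

    private
      q*[q⁻¹*x]≈x : ∀ x → q * (q⁻¹ * x) ≈ x
      q*[q⁻¹*x]≈x x = begin
        q * (q⁻¹ * x)  ≈⟨ *-assoc q q⁻¹ x ⟨
        q * q⁻¹ * x    ≈⟨ *-congʳ q*q⁻¹≈1 ⟩
        1# * x         ≈⟨ *-identityˡ x ⟩
        x              ∎

    zpow-suc : ∀ x → q^ (1ℤ +ᶻ x) ≈ q * q^ x
    zpow-suc (+ n)        = refl
    zpow-suc -[1+ zero ]  = sym (q*[q⁻¹*x]≈x 1#)
    zpow-suc -[1+ suc n ] = sym (q*[q⁻¹*x]≈x (q⁻¹ ^ suc n))

    -- Follows from `zpow-suc` at `-1ℤ +ᶻ x` by cancelling `q`, without a second case split on the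
    -- sign.
    zpow-pred : ∀ x → q^ (-1ℤ +ᶻ x) ≈ q⁻¹ * q^ x
    zpow-pred x = begin
      q^ (-1ℤ +ᶻ x)              ≈⟨ q*[q⁻¹*x]≈x _ ⟨
      q * (q⁻¹ * q^ (-1ℤ +ᶻ x))  ≈⟨ solve 3 (λ a b c → a :* (b :* c) := b :* (a :* c)) refl q q⁻¹ _ ⟩
      q⁻¹ * (q * q^ (-1ℤ +ᶻ x))  ≈⟨ *-congˡ (zpow-suc (-1ℤ +ᶻ x)) ⟨
      q⁻¹ * q^ (1ℤ +ᶻ (-1ℤ +ᶻ x))  ≡⟨ ≡.cong (λ y → q⁻¹ * q^ y) (1+[-1+x]≡x x) ⟩
      q⁻¹ * q^ x                 ∎
      where
      1+[-1+x]≡x : ∀ x → 1ℤ +ᶻ (-1ℤ +ᶻ x) ≡ x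
      1+[-1+x]≡x = ℤ.solve-∀

    zpow-homo-+ : ∀ x y → q^ (x +ᶻ y) ≈ q^ x * q^ y
    zpow-homo-+ (+ zero) y rewrite ℤ.+-identityˡ y = sym (*-identityˡ (q^ y))
    zpow-homo-+ (+ suc n) y = begin
      q^ (+ suc n +ᶻ y)       ≡⟨ ≡.cong q^ (ℤ.+-assoc 1ℤ (+ n) y) ⟩
      q^ (1ℤ +ᶻ (+ n +ᶻ y))   ≈⟨ zpow-suc (+ n +ᶻ y) ⟩
      q * q^ (+ n +ᶻ y)       ≈⟨ *-congˡ (zpow-homo-+ (+ n) y) ⟩
      q * (q^ (+ n) * q^ y)   ≈⟨ *-assoc _ _ _ ⟨
      q * q^ (+ n) * q^ y     ∎
    zpow-homo-+ -[1+ zero ] y =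
      trans (zpow-pred y) (*-congʳ (sym (*-identityʳ q⁻¹)))
    zpow-homo-+ -[1+ suc n ] y = begin
      q^ (-[1+ suc n ] +ᶻ y)          ≡⟨ ≡.cong q^ (ℤ.+-assoc -1ℤ -[1+ n ] y) ⟩
      q^ (-1ℤ +ᶻ (-[1+ n ] +ᶻ y))     ≈⟨ zpow-pred (-[1+ n ] +ᶻ y) ⟩
      q⁻¹ * q^ (-[1+ n ] +ᶻ y)        ≈⟨ *-congˡ (zpow-homo-+ -[1+ n ] y) ⟩
      q⁻¹ * (q^ -[1+ n ] * q^ y)      ≈⟨ *-assoc _ _ _ ⟨
      q⁻¹ * q^ -[1+ n ] * q^ y        ∎

    zpow-inverseˡ : ∀ x → q^ (-ᶻ x) * q^ x ≈ 1#
    zpow-inverseˡ x = trans (sym (zpow-homo-+ (-ᶻ x) x))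
                            (reflexive (≡.cong q^ (ℤ.+-inverseˡ x)))

    qNumber-0 : ∀ q#1? → qNumber q q#0 q#1? (+ 0) ≈ 0#
    qNumber-0 (yes q#1) = trans (*-congʳ (-‿inverseʳ 1#)) (zeroˡ _)
    qNumber-0 (no  _)   = refl

    -- Both branches of `qNumber` obey the same recursion. With the value at 0 it is all that the
    -- action below needs, so the case `q = 1` is never separated again.
    qNumber-suc : ∀ q#1? n → qNumber q q#0 q#1? (+ suc n) ≈
                             1# + q * qNumber q q#0 q#1? (+ n)
    qNumber-suc (yes q#1) n = begin
      (q * Q - 1#) * r                  ≈⟨ *-congʳ split ⟩
      ((q - 1#) + q * (Q - 1#)) * r     ≈⟨ distribʳ r _ _ ⟩
      (q - 1#) * r + q * (Q - 1#) * r   ≈⟨ +-cong (proj₂ (proj₂ (#⇒invertible q#1))) (*-assoc q _ r) ⟩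
      1# + q * ((Q - 1#) * r)           ∎
      where
      Q = q^ (+ n)
      r = proj₁ (#⇒invertible q#1)
      split : q * Q - 1# ≈ (q - 1#) + q * (Q - 1#)
      split = begin
        q * Q - 1#                           ≈⟨ +-identityʳ _ ⟨
        -- The solver works over semirings and sees `- 1#` as an atom, so the zero `q * (1# - 1#)`
        -- is inserted by hand.
        q * Q - 1# + 0#                      ≈⟨ +-congˡ (trans (*-congˡ (-‿inverseʳ 1#)) (zeroʳ q)) ⟨
        q * Q - 1# + q * (1# - 1#)           ≈⟨ solve 4 (λ a b m e → a :* b :+ m :+ a :* (con 1 :+ m)
                                                   := (a :+ m) :+ a :* (b :+ m)) refl q Q (- 1#) 1# ⟩
        (q - 1#) + q * (Q - 1#)              ∎
    -- Here tightness gives `q ≈ 1#`, so the factor `q` can be put in front for free.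
    qNumber-suc (no ¬q#1) n = +-congˡ (begin
      fromℤ (+ n)       ≈⟨ *-identityˡ _ ⟨
      1# * fromℤ (+ n)  ≈⟨ *-congʳ (proj₁ (tight q 1#) ¬q#1) ⟨
      q * fromℤ (+ n)   ∎)

-- Action of the algebra on functionals.

module Representation {c ℓ₁ ℓ₂} (F : HeytingField c ℓ₁ ℓ₂) (s : ℕ)
                      (h q : HeytingField.Carrier F)
                      (q#0 : FieldOps._#_ F q (FieldOps.0# F))
                      (q#1? : Dec (FieldOps._#_ F q (FieldOps.1# F))) where

  open FieldProperties F
  open Powers q q#0
  open NormalOrdering F s h q renaming (_^_ to _^ᴱ_)
  open import Relation.Binary.Reasoning.Setoid setoid

  [_] : ℤ → Carrier
  [_] = qNumber q q#0 q#1?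

  Form : Set c
  Form = ℕ → ℕ → Carrier

  -- A form φ stands for the linear functional V ^ i ⊗ U ^ j ↦ φ i j, and ⟦ x ⟧ φ
  -- for the functional y ↦ φ (x ⊗ y).  The clause for U encodes
  -- U V^i = q^i V^i U + h [i] V^(i+s-1); [0] = 0 makes the truncation harmless.
  ⟦_⟧ : Expr → Form → Form
  ⟦ const a ⟧ φ i j = a * φ i j
  ⟦ U ⟧       φ i j = q ^ i * φ i (suc j) + h * [ + i ] * φ (i ℕ.+ s ∸ 1) j
  ⟦ V ⟧       φ i j = φ (suc i) j
  ⟦ x ⊕ y ⟧   φ i j = ⟦ x ⟧ φ i j + ⟦ y ⟧ φ i j
  ⟦ x ⊗ y ⟧   φ     = ⟦ y ⟧ (⟦ x ⟧ φ)
  ⟦ ⊝ x ⟧     φ i j = - ⟦ x ⟧ φ i j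

  infix 4 _≗_
  _≗_ : Form → Form → Set ℓ₁
  φ ≗ ψ = ∀ i j → φ i j ≈ ψ i j

  ⟦⟧-cong : ∀ x {φ ψ} → φ ≗ ψ → ⟦ x ⟧ φ ≗ ⟦ x ⟧ ψ
  ⟦⟧-cong (const a) φ≗ψ i j = *-congˡ (φ≗ψ i j)
  ⟦⟧-cong U         φ≗ψ i j = +-cong (*-congˡ (φ≗ψ _ _)) (*-congˡ (φ≗ψ _ _))
  ⟦⟧-cong V         φ≗ψ i j = φ≗ψ (suc i) j
  ⟦⟧-cong (x ⊕ y)   φ≗ψ i j = +-cong (⟦⟧-cong x φ≗ψ i j) (⟦⟧-cong y φ≗ψ i j)
  ⟦⟧-cong (x ⊗ y)   φ≗ψ     = ⟦⟧-cong y (⟦⟧-cong x φ≗ψ)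
  ⟦⟧-cong (⊝ x)     φ≗ψ i j = -‿cong (⟦⟧-cong x φ≗ψ i j)

  -- Products act in reverse order: `(y ⊕ z) ⊗ x` applies `⟦ x ⟧` to a sum of two forms. Right
  -- distributivity is therefore additivity of `⟦ x ⟧`, and `const-central` is likewise its
  -- homogeneity, `⟦⟧-homo-*`.
  ⟦⟧-homo-+ : ∀ x φ ψ →
              ⟦ x ⟧ (λ i j → φ i j + ψ i j) ≗ λ i j → ⟦ x ⟧ φ i j + ⟦ x ⟧ ψ i j
  ⟦⟧-homo-+ (const a) φ ψ i j = distribˡ a _ _
  ⟦⟧-homo-+ U         φ ψ i j =
    solve 6 (λ a b x y z w → a :* (x :+ y) :+ b :* (z :+ w) :=
                             (a :* x :+ b :* z) :+ (a :* y :+ b :* w))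
      refl (q ^ i) (h * [ + i ]) _ _ _ _
  ⟦⟧-homo-+ V         φ ψ i j = refl
  ⟦⟧-homo-+ (x ⊕ y)   φ ψ i j = trans
    (+-cong (⟦⟧-homo-+ x φ ψ i j) (⟦⟧-homo-+ y φ ψ i j))
    (solve 4 (λ a b c d → (a :+ b) :+ (c :+ d) := (a :+ c) :+ (b :+ d)) refl _ _ _ _)
  ⟦⟧-homo-+ (x ⊗ y)   φ ψ i j = trans
    (⟦⟧-cong y (⟦⟧-homo-+ x φ ψ) i j)
    (⟦⟧-homo-+ y (⟦ x ⟧ φ) (⟦ x ⟧ ψ) i j)
  ⟦⟧-homo-+ (⊝ x)     φ ψ i j = trans
    (-‿cong (⟦⟧-homo-+ x φ ψ i j)) (sym (-‿+-comm _ _))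

  ⟦⟧-homo-* : ∀ x a φ → ⟦ x ⟧ (λ i j → a * φ i j) ≗ λ i j → a * ⟦ x ⟧ φ i j
  ⟦⟧-homo-* (const b) a φ i j =
    solve 3 (λ a b x → b :* (a :* x) := a :* (b :* x)) refl a b _
  ⟦⟧-homo-* U         a φ i j =
    solve 5 (λ a b d x y → b :* (a :* x) :+ d :* (a :* y) :=
                           a :* (b :* x :+ d :* y))
      refl a (q ^ i) (h * [ + i ]) _ _
  ⟦⟧-homo-* V         a φ i j = refl
  ⟦⟧-homo-* (x ⊕ y)   a φ i j = trans
    (+-cong (⟦⟧-homo-* x a φ i j) (⟦⟧-homo-* y a φ i j)) (sym (distribˡ a _ _))
  ⟦⟧-homo-* (x ⊗ y)   a φ i j = trans
    (⟦⟧-cong y (⟦⟧-homo-* x a φ) i j) (⟦⟧-homo-* y a (⟦ x ⟧ φ) i j)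
  ⟦⟧-homo-* (⊝ x)     a φ i j = trans
    (-‿cong (⟦⟧-homo-* x a φ i j)) (-‿distribʳ-* a _)

  h*[0]*x≈0 : ∀ x → h * [ + 0 ] * x ≈ 0#
  h*[0]*x≈0 x = begin
    h * [ + 0 ] * x  ≈⟨ *-congʳ (*-congˡ (qNumber-0 q#1?)) ⟩
    h * 0# * x       ≈⟨ *-congʳ (zeroʳ h) ⟩
    0# * x           ≈⟨ zeroˡ x ⟩
    0#               ∎

  ⟦V^⟧ : ∀ n φ i j → ⟦ V ^ᴱ n ⟧ φ i j ≈ φ (n ℕ.+ i) j
  ⟦V^⟧ zero    φ i j = *-identityˡ _
  ⟦V^⟧ (suc n) φ i j = ⟦V^⟧ n (⟦ V ⟧ φ) i j

  -- At `i = 0` there is no `V` for `U` to cross: the `h` term carries `[0] = 0`, and `U` only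
  -- raises `j`.
  ⟦U^⟧ : ∀ n φ j → ⟦ U ^ᴱ n ⟧ φ 0 j ≈ φ 0 (n ℕ.+ j)
  ⟦U^⟧ zero    φ j = *-identityˡ _
  ⟦U^⟧ (suc n) φ j = begin
    ⟦ U ^ᴱ n ⟧ (⟦ U ⟧ φ) 0 j                    ≈⟨ ⟦U^⟧ n (⟦ U ⟧ φ) j ⟩
    1# * φ 0 (suc (n ℕ.+ j)) + h * [ + 0 ] * _  ≈⟨ +-cong (*-identityˡ _) (h*[0]*x≈0 _) ⟩
    φ 0 (suc (n ℕ.+ j)) + 0#                    ≈⟨ +-identityʳ _ ⟩
    φ 0 (suc (n ℕ.+ j))                         ∎

  -- The leading `V` undoes the `∸ 1` in the action of `U`. At `i = 0` and `s = 0` the two indices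
  -- differ, but both terms carry `[0] = 0`.
  ⟦VU⟧ : ∀ φ i j → ⟦ V ⊗ U ⟧ φ i j ≈
                   q ^ i * φ (suc i) (suc j) + h * [ + i ] * φ (i ℕ.+ s) j
  ⟦VU⟧ φ zero    j = +-congˡ (trans (h*[0]*x≈0 _) (sym (h*[0]*x≈0 _)))
  ⟦VU⟧ φ (suc i) j = refl

  -- `UV` crosses `suc i` copies of `V` and `qVU` only `i`. The leading terms cancel, and
  -- `[i+1] - q[i] = 1` leaves exactly `h V^(i+s)`.
  ⟦relation⟧ : ∀ φ → ⟦ U ⊗ V ⊕ ⊝ (const q ⊗ (V ⊗ U)) ⟧ φ ≗ ⟦ const h ⊗ V ^ᴱ s ⟧ φ
  ⟦relation⟧ φ i j = begin
    q * q ^ i * x + h * [ + suc i ] * y - ⟦ const q ⊗ (V ⊗ U) ⟧ φ i j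
      ≈⟨ +-cong (+-congˡ (*-congʳ (*-congˡ (qNumber-suc q#1? i))))
                (-‿cong (⟦VU⟧ (⟦ const q ⟧ φ) i j)) ⟩
    q * q ^ i * x + h * (1# + q * [ + i ]) * y - z
      ≈⟨ +-congʳ (solve 6 (λ q Q x h n y →
           q :* Q :* x :+ h :* (con 1 :+ q :* n) :* y :=
           h :* y :+ (Q :* (q :* x) :+ h :* n :* (q :* y))) refl q (q ^ i) x h [ + i ] y) ⟩
    h * y + z - z    ≈⟨ +-assoc _ z (- z) ⟩
    h * y + (z - z)  ≈⟨ +-congˡ (-‿inverseʳ z) ⟩
    h * y + 0#       ≈⟨ +-identityʳ _ ⟩
    h * y            ≡⟨ ≡.cong (λ l → h * φ l j) (ℕ.+-comm i s) ⟩
    h * φ (s ℕ.+ i) j                  ≈⟨ ⟦V^⟧ s (⟦ const h ⟧ φ) i j ⟨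
    ⟦ V ^ᴱ s ⟧ (⟦ const h ⟧ φ) i j     ∎
    where
    x = φ (suc i) (suc j)
    y = φ (i ℕ.+ s) j
    z = q ^ i * (q * x) + h * [ + i ] * (q * y)

  -- The action respects every defining rule of the algebra, so an equation between words such as
  -- `IsNormalOrdering` becomes equations between field elements.
  ⟦⟧-sound : ∀ {x y} → x ≋ y → ∀ φ → ⟦ x ⟧ φ ≗ ⟦ y ⟧ φ
  ⟦⟧-sound ≋-refl              φ i j = refl
  ⟦⟧-sound (≋-sym e)           φ i j = sym (⟦⟧-sound e φ i j)
  ⟦⟧-sound (≋-trans d e)       φ i j = trans (⟦⟧-sound d φ i j) (⟦⟧-sound e φ i j)
  ⟦⟧-sound (⊕-cong d e)        φ i j = +-cong (⟦⟧-sound d φ i j) (⟦⟧-sound e φ i j)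
  ⟦⟧-sound (⊗-cong {y = y} d e) φ i j =
    trans (⟦⟧-cong y (⟦⟧-sound d φ) i j) (⟦⟧-sound e _ i j)
  ⟦⟧-sound (⊝-cong e)          φ i j = -‿cong (⟦⟧-sound e φ i j)
  ⟦⟧-sound (⊕-assoc x y z)     φ i j = +-assoc _ _ _
  ⟦⟧-sound (⊕-comm x y)        φ i j = +-comm _ _
  ⟦⟧-sound (⊕-identityˡ x)     φ i j = trans (+-congʳ (zeroˡ _)) (+-identityˡ _)
  ⟦⟧-sound (⊝-inverseˡ x)      φ i j = trans (-‿inverseˡ _) (sym (zeroˡ _))
  ⟦⟧-sound (⊗-assoc x y z)     φ i j = refl
  ⟦⟧-sound (⊗-identityˡ x)     φ i j = ⟦⟧-cong x (λ _ _ → *-identityˡ _) i j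
  ⟦⟧-sound (⊗-identityʳ x)     φ i j = *-identityˡ _
  ⟦⟧-sound (⊗-distribˡ x y z)  φ i j = refl
  ⟦⟧-sound (⊗-distribʳ x y z)  φ i j = ⟦⟧-homo-+ x (⟦ y ⟧ φ) (⟦ z ⟧ φ) i j
  ⟦⟧-sound (const-cong a≈b)    φ i j = *-congʳ a≈b
  ⟦⟧-sound (const-+ a b)       φ i j = distribʳ _ a b
  ⟦⟧-sound (const-* a b)       φ i j = trans (*-congʳ (*-comm a b)) (*-assoc b a _)
  ⟦⟧-sound (const-central a x) φ i j = ⟦⟧-homo-* x a φ i j
  ⟦⟧-sound relation            φ     = ⟦relation⟧ φ

-- Kronecker delta and extraction of a coefficient.

module Coefficients {c ℓ₁ ℓ₂} (F : HeytingField c ℓ₁ ℓ₂) where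

  open FieldProperties F
  open import Relation.Binary.Reasoning.Setoid setoid

  -- Recursion on both arguments makes `δ (suc m) (suc k)` compute to `δ m k`, which absorbs the
  -- shift `g (suc k)` in `∑-step`.
  δ : ℕ → ℕ → Carrier
  δ zero    zero    = 1#
  δ zero    (suc _) = 0#
  δ (suc _) zero    = 0#
  δ (suc m) (suc n) = δ m n

  ∑-zero : ∀ m n {f : ℕ → Carrier} → (∀ k → f k ≈ 0#) → ∑ m n f ≈ 0#
  ∑-zero m n {f} f≈0 = begin
    ∑ m n f                  ≈⟨ ∑-cong m n (λ j _ _ → trans (f≈0 j) (sym (zeroˡ 0#))) ⟩
    (∑[ _ ∈ m ⋯ n ] 0# * 0#) ≈⟨ *-distribˡ-∑ m n 0# (λ _ → 0#) ⟨
    0# * (∑[ _ ∈ m ⋯ n ] 0#) ≈⟨ zeroˡ _ ⟩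
    0#                       ∎

  ∑-δ : ∀ m n (f : ℕ → Carrier) → m ≤ n → ∑[ k ∈ 0 ⋯ n ] f k * δ m k ≈ f m
  ∑-δ zero zero f z≤n = trans (+-identityʳ _) (*-identityʳ _)
  ∑-δ zero (suc n) f z≤n = begin
    f 0 * 1# + (∑[ k ∈ 0 ⋯ n ] f (suc k) * 0#)
      ≈⟨ +-cong (*-identityʳ _) (∑-zero 0 n (λ k → zeroʳ (f (suc k)))) ⟩
    f 0 + 0#  ≈⟨ +-identityʳ _ ⟩
    f 0       ∎
  ∑-δ (suc m) (suc n) f (s≤s m≤n) = begin
    f 0 * 0# + (∑[ k ∈ 0 ⋯ n ] f (suc k) * δ m k)
      ≈⟨ +-cong (zeroʳ _) (∑-δ m n (f ∘ suc) m≤n) ⟩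
    0# + f (suc m)  ≈⟨ +-identityˡ _ ⟩
    f (suc m)       ∎

  ∑-δ-outside : ∀ m n (f : ℕ → Carrier) → n < m → ∑[ k ∈ 0 ⋯ n ] f k * δ m k ≈ 0#
  ∑-δ-outside (suc m) zero    f _ = trans (+-identityʳ _) (zeroʳ _)
  ∑-δ-outside (suc m) (suc n) f (s≤s n<m) =
    trans (+-cong (zeroʳ _) (∑-δ-outside m n (f ∘ suc) n<m)) (+-identityˡ 0#)

-- Recurrence for the normal ordering coefficients.

module Identities
  {c ℓ₁ ℓ₂} (F : HeytingField c ℓ₁ ℓ₂) (s : ℕ) (h q : HeytingField.Carrier F)
  (q#0 : FieldOps._#_ F q (FieldOps.0# F))
  (q#1? : Dec (FieldOps._#_ F q (FieldOps.1# F)))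
  (S : ℕ → ℕ → HeytingField.Carrier F)
  (expansion : NormalOrdering.IsNormalOrdering F s h q S) where

  open FieldProperties F
  open Powers q q#0
  open Coefficients F
  open Representation F s h q q#0 q#1?
  open NormalOrdering F s h q renaming (_^_ to _^ᴱ_; rawSemiring to rawSemiringᴱ)
  open import Relation.Binary.Reasoning.Setoid setoid

  private
    V-degree : ℕ → ℕ → ℕ
    V-degree n k = s ℕ.* (n ∸ k) ℕ.+ k

  ⟦∑⟧ : ∀ n (f : ℕ → Expr) φ i j →
        ⟦ bigOp (RawSemiring.+-rawMonoid rawSemiringᴱ) 0 n f ⟧ φ i j ≈
        ∑[ k ∈ 0 ⋯ n ] ⟦ f k ⟧ φ i j
  ⟦∑⟧ zero    f φ i j = +-congˡ (zeroˡ _)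
  ⟦∑⟧ (suc n) f φ i j = +-congˡ (⟦∑⟧ n (f ∘ suc) φ i j)

  -- Evaluation at `0 0` applies the functional to `(VU)^n` itself, and the expansion reduces this
  -- to values of `φ` on normally ordered monomials.
  ⟦[VU]^⟧ : ∀ n φ → ⟦ (V ⊗ U) ^ᴱ n ⟧ φ 0 0 ≈ ∑[ k ∈ 0 ⋯ n ] S n k * φ (V-degree n k) k
  ⟦[VU]^⟧ n φ = begin
    ⟦ (V ⊗ U) ^ᴱ n ⟧ φ 0 0  ≈⟨ ⟦⟧-sound (expansion n) φ 0 0 ⟩
    _                       ≈⟨ ⟦∑⟧ n monomial φ 0 0 ⟩
    (∑[ k ∈ 0 ⋯ n ] ⟦ monomial k ⟧ φ 0 0)
      ≈⟨ ∑-cong 0 n (λ k _ _ → ⟦monomial⟧ k) ⟩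
    (∑[ k ∈ 0 ⋯ n ] S n k * φ (V-degree n k) k)  ∎
    where
    monomial : ℕ → Expr
    monomial k = const (S n k) ⊗ (V ^ᴱ V-degree n k ⊗ U ^ᴱ k)
    ⟦monomial⟧ : ∀ k → ⟦ monomial k ⟧ φ 0 0 ≈ S n k * φ (V-degree n k) k
    ⟦monomial⟧ k = begin
      ⟦ monomial k ⟧ φ 0 0  ≈⟨ ⟦U^⟧ k (⟦ const (S n k) ⊗ V ^ᴱ V-degree n k ⟧ φ) 0 ⟩
      _                     ≈⟨ ⟦V^⟧ (V-degree n k) (⟦ const (S n k) ⟧ φ) 0 (k ℕ.+ 0) ⟩
      S n k * φ (V-degree n k ℕ.+ 0) (k ℕ.+ 0)
        ≡⟨ ≡.cong₂ (λ i j → S n k * φ i j) (ℕ.+-identityʳ _) (ℕ.+-identityʳ k) ⟩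
      S n k * φ (V-degree n k) k  ∎

  private
    -- With `d = V-degree n k`, multiplying `V^d U^k` by `VU` gives
    -- `q^d V^(d+1) U^(k+1) + h [d] V^(d+s) U^k`: one part raises the power of `U`, the other keeps
    -- it.
    up level : ℕ → ℕ → Carrier
    up    n k = q ^ V-degree n k * S n k
    level n k = h * [ + V-degree n k ] * S n k

  -- This is (VU)^(n+1) = VU (VU)^n, evaluated on a form that ignores the power of V.
  ∑-step : ∀ n (g : ℕ → Carrier) →
           ∑[ k ∈ 0 ⋯ suc n ] S (suc n) k * g k ≈
           (∑[ k ∈ 0 ⋯ n ] up n k * g (suc k)) + (∑[ k ∈ 0 ⋯ n ] level n k * g k)
  ∑-step n g = begin
    (∑[ k ∈ 0 ⋯ suc n ] S (suc n) k * g k)  ≈⟨ ⟦[VU]^⟧ (suc n) φ ⟨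
    ⟦ (V ⊗ U) ^ᴱ n ⟧ (⟦ V ⊗ U ⟧ φ) 0 0      ≈⟨ ⟦[VU]^⟧ n (⟦ V ⊗ U ⟧ φ) ⟩
    (∑[ k ∈ 0 ⋯ n ] S n k * ⟦ V ⊗ U ⟧ φ (V-degree n k) k)
      ≈⟨ ∑-cong 0 n (λ k _ _ → apply-VU k) ⟩
    (∑[ k ∈ 0 ⋯ n ] (up n k * g (suc k) + level n k * g k))
      ≈⟨ ∑-homo-+ 0 n (λ k → up n k * g (suc k)) (λ k → level n k * g k) ⟩
    (∑[ k ∈ 0 ⋯ n ] up n k * g (suc k)) + (∑[ k ∈ 0 ⋯ n ] level n k * g k)  ∎
    where
    φ : Form
    φ _ = g
    apply-VU : ∀ k → S n k * ⟦ V ⊗ U ⟧ φ (V-degree n k) k ≈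
                     up n k * g (suc k) + level n k * g k
    apply-VU k = trans (*-congˡ (⟦VU⟧ φ (V-degree n k) k))
      (solve 5 (λ T Q x b y → T :* (Q :* x :+ b :* y) := Q :* T :* x :+ b :* T :* y)
        refl (S n k) (q ^ V-degree n k) (g (suc k)) (h * [ + V-degree n k ]) (g k))

  -- The integer form of `V-degree`, equal to it when `k ≤ n`; integers allow the negated exponents
  -- of the row expansion.
  exponent : ℕ → ℕ → ℤ
  exponent n k = + s *ᶻ + n -ᶻ (+ s -ᶻ 1ℤ) *ᶻ + k

  private
    V-degree≡exponent : ∀ {n k} → k ≤ n → + V-degree n k ≡ exponent n k
    V-degree≡exponent {n} {k} k≤n = ≡.trans
      (≡.trans (≡.cong (_+ᶻ + k) (ℤ.pos-* s (n ∸ k)))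
               (rearrange (+ s) (+ (n ∸ k)) (+ k)))
      (≡.cong (λ m → exponent m k) (ℕ.m∸n+n≡m k≤n))
      where
      rearrange : ∀ s d k → s *ᶻ d +ᶻ k ≡ s *ᶻ (d +ᶻ k) -ᶻ (s -ᶻ 1ℤ) *ᶻ k
      rearrange = ℤ.solve-∀

  -- The test sequence `δ 0` kills the `up` part, which has only positive powers of `U`.
  S-zero : ∀ n → S (suc n) 0 ≈ h * [ exponent n 0 ] * S n 0
  S-zero n = begin
    S (suc n) 0                               ≈⟨ ∑-δ 0 (suc n) (S (suc n)) z≤n ⟨
    (∑[ k ∈ 0 ⋯ suc n ] S (suc n) k * δ 0 k)  ≈⟨ ∑-step n (δ 0) ⟩
    (∑[ k ∈ 0 ⋯ n ] up n k * 0#) + (∑[ k ∈ 0 ⋯ n ] level n k * δ 0 k)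
      ≈⟨ +-cong (∑-zero 0 n (λ k → zeroʳ (up n k))) (∑-δ 0 n (level n) z≤n) ⟩
    0# + level n 0                            ≈⟨ +-identityˡ _ ⟩
    level n 0                                 ≡⟨ ≡.cong (λ x → h * [ x ] * S n 0) (V-degree≡exponent {n} z≤n) ⟩
    h * [ exponent n 0 ] * S n 0              ∎

  -- The test sequence `δ (suc k)` meets the `up` sum at `k` and the `level` sum at `suc k`; the
  -- latter index is in range because `k < n`.
  S-suc : ∀ {n k} → k < n →
          S (suc n) (suc k) ≈
          q^ (exponent n k) * S n k + h * [ exponent n (suc k) ] * S n (suc k)
  S-suc {n} {k} k<n = begin
    S (suc n) (suc k)  ≈⟨ ∑-δ (suc k) (suc n) (S (suc n)) (s≤s k≤n) ⟨
    (∑[ l ∈ 0 ⋯ suc n ] S (suc n) l * δ (suc k) l)  ≈⟨ ∑-step n (δ (suc k)) ⟩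
    (∑[ l ∈ 0 ⋯ n ] up n l * δ k l) + (∑[ l ∈ 0 ⋯ n ] level n l * δ (suc k) l)
      ≈⟨ +-cong (∑-δ k n (up n) k≤n) (∑-δ (suc k) n (level n) k<n) ⟩
    up n k + level n (suc k)
      ≡⟨ ≡.cong₂ (λ x y → q^ x * S n k + h * [ y ] * S n (suc k))
           (V-degree≡exponent k≤n) (V-degree≡exponent k<n) ⟩
    q^ (exponent n k) * S n k + h * [ exponent n (suc k) ] * S n (suc k)  ∎
    where k≤n = ℕ.<⇒≤ k<n

  -- Here `suc n` lies outside the `level` sum, so nothing is asked of the unconstrained value
  -- `S n (suc n)`.
  S-diagonal : ∀ n → S (suc n) (suc n) ≈ q^ (exponent n n) * S n n
  S-diagonal n = begin
    S (suc n) (suc n)  ≈⟨ ∑-δ (suc n) (suc n) (S (suc n)) ℕ.≤-refl ⟨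
    (∑[ l ∈ 0 ⋯ suc n ] S (suc n) l * δ (suc n) l)  ≈⟨ ∑-step n (δ (suc n)) ⟩
    (∑[ l ∈ 0 ⋯ n ] up n l * δ n l) + (∑[ l ∈ 0 ⋯ n ] level n l * δ (suc n) l)
      ≈⟨ +-cong (∑-δ n n (up n) ℕ.≤-refl) (∑-δ-outside (suc n) n (level n) ℕ.≤-refl) ⟩
    up n n + 0#                ≈⟨ +-identityʳ _ ⟩
    up n n                     ≡⟨ ≡.cong (λ x → q^ x * S n n) (V-degree≡exponent {n} ℕ.≤-refl) ⟩
    q^ (exponent n n) * S n n  ∎

  private
    s-1 : ℤ
    s-1 = + s -ᶻ 1ℤ

    -- Pascal's rule; it turns the shifts of binomial exponents below into ring identities over the
    -- integers.
    [1+n]C2 : ∀ n → + (suc n C 2) ≡ + n +ᶻ + (n C 2)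
    [1+n]C2 n = ≡.cong +_ (≡.trans (≡.sym (nCk+nC[k+1]≡[n+1]C[k+1] n 1))
                                   (≡.cong (ℕ._+ n C 2) (nC1≡n n)))

  -- Expansion along a column.

  columnTerm : ℕ → ℕ → ℕ → Carrier
  columnTerm n k j =
    h ^ (n ∸ j)
      * q^ (+ s *ᶻ (+ j -ᶻ 1ℤ) -ᶻ s-1 *ᶻ (+ k -ᶻ 1ℤ))
      * S (j ∸ 1) (k ∸ 1)
      * (∏[ i ∈ j ⋯ n ∸ 1 ] [ exponent i k ])

  -- The power of `h` is trivial and the product empty, so the last summand is the first term of the
  -- recurrence.
  columnTerm-diagonal : ∀ n k →
    columnTerm (suc n) (suc k) (suc n) ≈ q^ (exponent n k) * S n k
  columnTerm-diagonal n k = begin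
    h ^ (n ∸ n) * q^ e * S n k * (∏[ i ∈ suc n ⋯ n ] [ exponent i (suc k) ])
      ≈⟨ *-cong (*-congʳ (*-cong (reflexive (≡.cong (h ^_) (ℕ.n∸n≡0 n)))
                                 (reflexive (≡.cong q^ (cancel (+ s) (+ n) (+ k))))))
                (∏-empty (λ i → [ exponent i (suc k) ]) (ℕ.n<1+n n)) ⟩
    1# * q^ (exponent n k) * S n k * 1#  ≈⟨ *-identityʳ _ ⟩
    1# * q^ (exponent n k) * S n k       ≈⟨ *-congʳ (*-identityˡ _) ⟩
    q^ (exponent n k) * S n k            ∎
    where
    e = + s *ᶻ (+ suc n -ᶻ 1ℤ) -ᶻ s-1 *ᶻ (+ suc k -ᶻ 1ℤ)
    cancel : ∀ s n k → s *ᶻ ((1ℤ +ᶻ n) -ᶻ 1ℤ) -ᶻ (s -ᶻ 1ℤ) *ᶻ ((1ℤ +ᶻ k) -ᶻ 1ℤ) ≡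
                       s *ᶻ n -ᶻ (s -ᶻ 1ℤ) *ᶻ k
    cancel = ℤ.solve-∀

  -- Raising the row index adds one power of `h` and the factor at `i = suc n`, together the
  -- coefficient of the second term of the recurrence.
  columnTerm-suc : ∀ n k j → j ≤ suc n →
    columnTerm (suc (suc n)) k j ≈ h * [ exponent (suc n) k ] * columnTerm (suc n) k j
  columnTerm-suc n k j j≤1+n = begin
    h ^ (suc (suc n) ∸ j) * Q * T * ∏ j (suc n) f
      ≈⟨ *-cong (*-congʳ (*-congʳ (reflexive (≡.cong (h ^_) (ℕ.+-∸-assoc 1 j≤1+n)))))
                (∏-last f j≤1+n) ⟩
    h * h ^ (suc n ∸ j) * Q * T * (∏ j n f * f (suc n))
      ≈⟨ solve 6 (λ h x Q T P b → h :* x :* Q :* T :* (P :* b) :=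
                                  h :* b :* (x :* Q :* T :* P))
           refl h (h ^ (suc n ∸ j)) Q T (∏ j n f) (f (suc n)) ⟩
    h * f (suc n) * columnTerm (suc n) k j  ∎
    where
    f : ℕ → Carrier
    f i = [ exponent i k ]
    Q = q^ (+ s *ᶻ (+ j -ᶻ 1ℤ) -ᶻ s-1 *ᶻ (+ k -ᶻ 1ℤ))
    T = S (j ∸ 1) (k ∸ 1)

  -- Induction on `n` with `k` fixed: the first term of the recurrence becomes the last summand, the
  -- second is expanded again, and the diagonal ends the descent.
  column-expansion : ∀ n k → k ≤ n →
    S (suc n) (suc k) ≈ ∑ (suc k) (suc n) (columnTerm (suc n) (suc k))
  column-expansion n k k≤n with ℕ.m≤n⇒m<n∨m≡n k≤n
  ... | inj₂ ≡.refl = begin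
    S (suc n) (suc n)           ≈⟨ S-diagonal n ⟩
    q^ (exponent n n) * S n n   ≈⟨ columnTerm-diagonal n n ⟨
    t (suc n)                   ≈⟨ +-identityˡ _ ⟨
    0# + t (suc n)              ≈⟨ +-congʳ (∑-empty t (ℕ.n<1+n n)) ⟨
    ∑ (suc n) n t + t (suc n)   ≈⟨ ∑-last t ℕ.≤-refl ⟨
    ∑ (suc n) (suc n) t         ∎
    where t = columnTerm (suc n) (suc n)
  column-expansion (suc n) k _ | inj₁ (s≤s k≤n) = begin
    S (suc (suc n)) (suc k)  ≈⟨ S-suc (s≤s k≤n) ⟩
    q^ (exponent (suc n) k) * S (suc n) k + x * S (suc n) (suc k)
      ≈⟨ +-cong (columnTerm-diagonal (suc n) k) (*-congˡ (sym (column-expansion n k k≤n))) ⟨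
    t′ (suc (suc n)) + x * ∑ (suc k) (suc n) t   ≈⟨ +-comm _ _ ⟩
    x * ∑ (suc k) (suc n) t + t′ (suc (suc n))
      ≈⟨ +-congʳ (*-distribˡ-∑ (suc k) (suc n) x t) ⟩
    (∑[ j ∈ suc k ⋯ suc n ] x * t j) + t′ (suc (suc n))
      ≈⟨ +-congʳ (∑-cong (suc k) (suc n) λ j _ j≤1+n → columnTerm-suc n (suc k) j j≤1+n) ⟨
    ∑ (suc k) (suc n) t′ + t′ (suc (suc n))
      ≈⟨ ∑-last t′ (s≤s (ℕ.m≤n⇒m≤1+n k≤n)) ⟨
    ∑ (suc k) (suc (suc n)) t′  ∎
    where
    x = h * [ exponent (suc n) (suc k) ]
    t = columnTerm (suc n) (suc k)
    t′ = columnTerm (suc (suc n)) (suc k)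

  -- Expansion along a row.

  rowTerm : ℕ → ℕ → ℕ → Carrier
  rowTerm n k j =
    (- h) ^ (j ∸ k)
      * q^ (+ s *ᶻ + n *ᶻ (+ k -ᶻ + j -ᶻ 1ℤ) +ᶻ s-1 *ᶻ + (suc j C 2) -ᶻ s-1 *ᶻ + (k C 2))
      * S (suc n) (suc j)
      * (∏[ i ∈ suc k ⋯ j ] [ exponent n i ])

  -- `suc k C 2` exceeds `k C 2` by `k`, so the exponent collapses to `-ᶻ exponent n k`.
  rowTerm-diagonal : ∀ n k → rowTerm n k k ≈ q^ (-ᶻ exponent n k) * S (suc n) (suc k)
  rowTerm-diagonal n k = begin
    (- h) ^ (k ∸ k) * q^ (e (+ (suc k C 2))) * S (suc n) (suc k) * ∏ (suc k) k (λ i → [ exponent n i ])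
      ≈⟨ *-cong (*-congʳ (*-cong (reflexive (≡.cong ((- h) ^_) (ℕ.n∸n≡0 k)))
                                 (reflexive (≡.cong q^ e≡))))
                (∏-empty (λ i → [ exponent n i ]) (ℕ.n<1+n k)) ⟩
    1# * q^ (-ᶻ exponent n k) * S (suc n) (suc k) * 1#  ≈⟨ *-identityʳ _ ⟩
    1# * q^ (-ᶻ exponent n k) * S (suc n) (suc k)       ≈⟨ *-congʳ (*-identityˡ _) ⟩
    q^ (-ᶻ exponent n k) * S (suc n) (suc k)            ∎
    where
    e : ℤ → ℤ
    e a = + s *ᶻ + n *ᶻ (+ k -ᶻ + k -ᶻ 1ℤ) +ᶻ s-1 *ᶻ a -ᶻ s-1 *ᶻ + (k C 2)
    collect : ∀ s n k b →
      s *ᶻ n *ᶻ (k -ᶻ k -ᶻ 1ℤ) +ᶻ (s -ᶻ 1ℤ) *ᶻ (k +ᶻ b) -ᶻ (s -ᶻ 1ℤ) *ᶻ b ≡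
      -ᶻ (s *ᶻ n -ᶻ (s -ᶻ 1ℤ) *ᶻ k)
    collect = ℤ.solve-∀
    e≡ : e (+ (suc k C 2)) ≡ -ᶻ exponent n k
    e≡ = ≡.trans (≡.cong e ([1+n]C2 k)) (collect (+ s) (+ n) (+ k) (+ (k C 2)))

  -- The lowest factor of the product and one `- h` split off. In the exponent the linear part
  -- contributes `-sn` and `k C 2` contributes `(s-1)k`, in total `-ᶻ exponent n k`.
  rowTerm-suc : ∀ n k j → suc k ≤ j →
    rowTerm n k j ≈
    - h * [ exponent n (suc k) ] * q^ (-ᶻ exponent n k) * rowTerm n (suc k) j
  rowTerm-suc n k j k<j = begin
    (- h) ^ (j ∸ k) * q^ (e k (+ (k C 2))) * T * ∏ (suc k) j f
      ≈⟨ *-cong (*-congʳ (*-cong (reflexive (≡.cong ((- h) ^_) (ℕ.+-∸-assoc 1 k<j)))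
                                 q^-split))
                (∏-head f k<j) ⟩
    - h * x * (p * Q) * T * (f (suc k) * P)
      ≈⟨ solve 7 (λ h x p Q T b P → h :* x :* (p :* Q) :* T :* (b :* P) :=
                                    h :* b :* p :* (x :* Q :* T :* P))
           refl (- h) x p Q T (f (suc k)) P ⟩
    - h * f (suc k) * p * rowTerm n (suc k) j  ∎
    where
    f : ℕ → Carrier
    f i = [ exponent n i ]
    e : ℕ → ℤ → ℤ
    e k b = + s *ᶻ + n *ᶻ (+ k -ᶻ + j -ᶻ 1ℤ) +ᶻ s-1 *ᶻ + (suc j C 2) -ᶻ s-1 *ᶻ b
    x = (- h) ^ (j ∸ suc k)
    p = q^ (-ᶻ exponent n k)
    Q = q^ (e (suc k) (+ (suc k C 2)))
    T = S (suc n) (suc j)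
    P = ∏ (suc (suc k)) j f
    collect : ∀ s n k j a b →
      s *ᶻ n *ᶻ (k -ᶻ j -ᶻ 1ℤ) +ᶻ (s -ᶻ 1ℤ) *ᶻ a -ᶻ (s -ᶻ 1ℤ) *ᶻ b ≡
      -ᶻ (s *ᶻ n -ᶻ (s -ᶻ 1ℤ) *ᶻ k) +ᶻ
      (s *ᶻ n *ᶻ ((1ℤ +ᶻ k) -ᶻ j -ᶻ 1ℤ) +ᶻ (s -ᶻ 1ℤ) *ᶻ a -ᶻ (s -ᶻ 1ℤ) *ᶻ (k +ᶻ b))
    collect = ℤ.solve-∀
    q^-split : q^ (e k (+ (k C 2))) ≈ p * Q
    q^-split = begin
      q^ (e k (+ (k C 2)))
        ≡⟨ ≡.cong q^ (collect (+ s) (+ n) (+ k) (+ j) (+ (suc j C 2)) (+ (k C 2))) ⟩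
      q^ (-ᶻ exponent n k +ᶻ e (suc k) (+ k +ᶻ + (k C 2)))
        ≡⟨ ≡.cong (λ b → q^ (-ᶻ exponent n k +ᶻ e (suc k) b)) ([1+n]C2 k) ⟨
      q^ (-ᶻ exponent n k +ᶻ e (suc k) (+ (suc k C 2)))
        ≈⟨ zpow-homo-+ (-ᶻ exponent n k) _ ⟩
      p * Q  ∎

  private
    q^-solve : ∀ x {a b} → a ≈ q^ x * b → b ≈ q^ (-ᶻ x) * a
    q^-solve x {a} {b} a≈ = begin
      b                          ≈⟨ *-identityˡ b ⟨
      1# * b                     ≈⟨ *-congʳ (zpow-inverseˡ x) ⟨
      q^ (-ᶻ x) * q^ x * b       ≈⟨ *-assoc _ _ b ⟩
      q^ (-ᶻ x) * (q^ x * b)     ≈⟨ *-congˡ a≈ ⟨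
      q^ (-ᶻ x) * a              ∎

  -- `S-suc` solved for its first term by dividing by a power of `q`; the remaining entry of row `n`
  -- lies one column further.
  S-descend : ∀ {n k} → k < n →
    S n k ≈ q^ (-ᶻ exponent n k) * S (suc n) (suc k) +
            - h * [ exponent n (suc k) ] * q^ (-ᶻ exponent n k) * S n (suc k)
  S-descend {n} {k} k<n = begin
    S n k                         ≈⟨ q^-solve (exponent n k) a-hbT≈ ⟩
    p * (a + - h * b * T)         ≈⟨ solve 5 (λ p a h b T → p :* (a :+ h :* b :* T) :=
                                       p :* a :+ h :* b :* p :* T) refl p a (- h) b T ⟩
    p * a + - h * b * p * T       ∎
    where
    p = q^ (-ᶻ exponent n k)
    a = S (suc n) (suc k)
    b = [ exponent n (suc k) ]
    T = S n (suc k)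
    y = q^ (exponent n k) * S n k
    a-hbT≈ : a + - h * b * T ≈ y
    a-hbT≈ = begin
      a + - h * b * T                ≈⟨ +-congʳ (S-suc k<n) ⟩
      y + h * b * T + - h * b * T    ≈⟨ solve 5 (λ y h m b T → y :+ h :* b :* T :+ m :* b :* T :=
                                          y :+ (h :+ m) :* (b :* T)) refl y h (- h) b T ⟩
      y + (h - h) * (b * T)          ≈⟨ +-congˡ (*-congʳ (-‿inverseʳ h)) ⟩
      y + 0# * (b * T)               ≈⟨ +-congˡ (zeroˡ _) ⟩
      y + 0#                         ≈⟨ +-identityʳ y ⟩
      y                              ∎

  row-expansion : ∀ n k → k ≤ n → S n k ≈ ∑ k n (rowTerm n k)
  -- Recursion is on the distance `n ∸ k`, as each use of `S-descend` moves `k` up towards the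
  -- diagonal.
  row-expansion n k k≤n = go (n ∸ k) k (ℕ.m∸n+n≡m k≤n)
    where
    go : ∀ d k → d ℕ.+ k ≡ n → S n k ≈ ∑ k n (rowTerm n k)
    go zero .n ≡.refl = begin
      S n n                  ≈⟨ q^-solve (exponent n n) (S-diagonal n) ⟩
      q^ (-ᶻ exponent n n) * S (suc n) (suc n)  ≈⟨ rowTerm-diagonal n n ⟨
      t n                    ≈⟨ +-identityʳ _ ⟨
      t n + 0#               ≈⟨ +-congˡ (∑-empty t (ℕ.n<1+n n)) ⟨
      t n + ∑ (suc n) n t    ≈⟨ ∑-head t ℕ.≤-refl ⟨
      ∑ n n t                ∎
      where t = rowTerm n n
    go (suc d) k 1+d+k≡n = begin
      S n k  ≈⟨ S-descend k<n ⟩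
      q^ (-ᶻ exponent n k) * S (suc n) (suc k) + x * S n (suc k)
        ≈⟨ +-cong (rowTerm-diagonal n k) (*-congˡ (sym (go d (suc k) d+1+k≡n))) ⟨
      t k + x * ∑ (suc k) n t′
        ≈⟨ +-congˡ (*-distribˡ-∑ (suc k) n x t′) ⟩
      t k + (∑[ j ∈ suc k ⋯ n ] x * t′ j)
        ≈⟨ +-congˡ (∑-cong (suc k) n λ j k<j _ → rowTerm-suc n k j k<j) ⟨
      t k + ∑ (suc k) n t  ≈⟨ ∑-head t (ℕ.<⇒≤ k<n) ⟨
      ∑ k n t              ∎
      where
      x = - h * [ exponent n (suc k) ] * q^ (-ᶻ exponent n k)
      t = rowTerm n k
      t′ = rowTerm n (suc k)
      d+1+k≡n : d ℕ.+ suc k ≡ n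
      d+1+k≡n = ≡.trans (ℕ.+-suc d k) 1+d+k≡n
      k<n : k < n
      k<n = ≡.subst (k <_) d+1+k≡n (ℕ.m≤n+m (suc k) d)

  -- Expansion along a diagonal.

  diagonalTerm : ℕ → ℕ → ℕ → Carrier
  diagonalTerm n k j =
    h * q^ (+ j *ᶻ (+ s *ᶻ + n -ᶻ s-1 *ᶻ + k) -ᶻ + (suc j C 2))
      * [ + s *ᶻ (+ n -ᶻ + j -ᶻ 1ℤ) -ᶻ s-1 *ᶻ (+ k -ᶻ + j) ]
      * S (n ∸ j ∸ 1) (k ∸ j)

  diagonalTerm-zero : ∀ n k → diagonalTerm (suc n) k 0 ≈ h * [ exponent n k ] * S n k
  diagonalTerm-zero n k = *-congʳ (*-cong
    -- `1 C 2` computes to 0, so the whole exponent vanishes.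
    (trans (*-congˡ (reflexive (≡.cong q^ (vanish (exponent (suc n) k))))) (*-identityʳ h))
    (reflexive (≡.cong [_] (collect (+ s) (+ n) (+ k)))))
    where
    vanish : ∀ x → + 0 *ᶻ x -ᶻ + 0 ≡ + 0
    vanish = ℤ.solve-∀
    collect : ∀ s n k → s *ᶻ ((1ℤ +ᶻ n) -ᶻ + 0 -ᶻ 1ℤ) -ᶻ (s -ᶻ 1ℤ) *ᶻ (k -ᶻ + 0) ≡
                        s *ᶻ n -ᶻ (s -ᶻ 1ℤ) *ᶻ k
    collect = ℤ.solve-∀

  -- The q-number and the entry of `S` depend only on `n - j` and `k - j`. In the exponent,
  -- `exponent` grows by 1 under the joint shift of `n` and `k`; the resulting extra `j + 1` is
  -- cancelled by the growth of the binomial.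
  diagonalTerm-suc : ∀ n k j →
    diagonalTerm (suc n) (suc k) (suc j) ≈ q^ (exponent n k) * diagonalTerm n k j
  diagonalTerm-suc n k j = begin
    h * q^ e′ * [ + s *ᶻ (+ suc n -ᶻ + suc j -ᶻ 1ℤ) -ᶻ s-1 *ᶻ (+ suc k -ᶻ + suc j) ] * T
      ≈⟨ *-congʳ (*-cong (*-congˡ q^-split)
           (reflexive (≡.cong [_] (shift (+ s) (+ n) (+ k) (+ j))))) ⟩
    h * (q^ (exponent n k) * q^ e) * b * T
      ≈⟨ solve 5 (λ h x Q b T → h :* (x :* Q) :* b :* T := x :* (h :* Q :* b :* T))
           refl h (q^ (exponent n k)) (q^ e) b T ⟩
    q^ (exponent n k) * diagonalTerm n k j  ∎
    where
    e  = + j *ᶻ exponent n k -ᶻ + (suc j C 2)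
    e′ = + suc j *ᶻ exponent (suc n) (suc k) -ᶻ + (suc (suc j) C 2)
    b  = [ + s *ᶻ (+ n -ᶻ + j -ᶻ 1ℤ) -ᶻ s-1 *ᶻ (+ k -ᶻ + j) ]
    T  = S (n ∸ j ∸ 1) (k ∸ j)
    shift : ∀ s n k j →
      s *ᶻ ((1ℤ +ᶻ n) -ᶻ (1ℤ +ᶻ j) -ᶻ 1ℤ) -ᶻ (s -ᶻ 1ℤ) *ᶻ ((1ℤ +ᶻ k) -ᶻ (1ℤ +ᶻ j)) ≡
      s *ᶻ (n -ᶻ j -ᶻ 1ℤ) -ᶻ (s -ᶻ 1ℤ) *ᶻ (k -ᶻ j)
    shift = ℤ.solve-∀
    collect : ∀ s n k j a →
      (1ℤ +ᶻ j) *ᶻ (s *ᶻ (1ℤ +ᶻ n) -ᶻ (s -ᶻ 1ℤ) *ᶻ (1ℤ +ᶻ k)) -ᶻ ((1ℤ +ᶻ j) +ᶻ a) ≡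
      (s *ᶻ n -ᶻ (s -ᶻ 1ℤ) *ᶻ k) +ᶻ (j *ᶻ (s *ᶻ n -ᶻ (s -ᶻ 1ℤ) *ᶻ k) -ᶻ a)
    collect = ℤ.solve-∀
    q^-split : q^ e′ ≈ q^ (exponent n k) * q^ e
    q^-split = begin
      q^ e′
        ≡⟨ ≡.cong (λ a → q^ (+ suc j *ᶻ exponent (suc n) (suc k) -ᶻ a)) ([1+n]C2 (suc j)) ⟩
      q^ (+ suc j *ᶻ exponent (suc n) (suc k) -ᶻ (+ suc j +ᶻ + (suc j C 2)))
        ≡⟨ ≡.cong q^ (collect (+ s) (+ n) (+ k) (+ j) (+ (suc j C 2))) ⟩
      q^ (exponent n k +ᶻ e)  ≈⟨ zpow-homo-+ (exponent n k) e ⟩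
      q^ (exponent n k) * q^ e  ∎

  -- The first term of the recurrence lowers `n` and `k` together, so the recursion keeps `n - k`
  -- and stops at `k = 0`, where `S-zero` has a single term.
  diagonal-expansion : ∀ n k → k < n → S n k ≈ ∑ 0 k (diagonalTerm n k)
  diagonal-expansion (suc n) zero k<n = begin
    S (suc n) 0                     ≈⟨ S-zero n ⟩
    h * [ exponent n 0 ] * S n 0    ≈⟨ diagonalTerm-zero n 0 ⟨
    diagonalTerm (suc n) 0 0        ≈⟨ +-identityʳ _ ⟨
    diagonalTerm (suc n) 0 0 + 0#   ∎
  diagonal-expansion (suc n) (suc k) (s≤s k<n) = begin
    S (suc n) (suc k)  ≈⟨ S-suc k<n ⟩
    x * S n k + h * [ exponent n (suc k) ] * S n (suc k)  ≈⟨ +-comm _ _ ⟩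
    h * [ exponent n (suc k) ] * S n (suc k) + x * S n k
      ≈⟨ +-cong (diagonalTerm-zero n (suc k)) (*-congˡ (sym (diagonal-expansion n k k<n))) ⟨
    t′ 0 + x * ∑ 0 k t
      ≈⟨ +-congˡ (*-distribˡ-∑ 0 k x t) ⟩
    t′ 0 + (∑[ j ∈ 0 ⋯ k ] x * t j)
      ≈⟨ +-congˡ (∑-cong 0 k λ j _ _ → diagonalTerm-suc n k j) ⟨
    -- With lower bound 0 the sum up to `suc k` unfolds to this by computation.
    t′ 0 + ∑ 0 k (t′ ∘ suc)  ∎
    where
    x = q^ (exponent n k)
    t = diagonalTerm n k
    t′ = diagonalTerm (suc n) (suc k)

corollary6 :
  ∀ {c ℓ₁ ℓ₂} (F : HeytingField c ℓ₁ ℓ₂) →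
  let open FieldOps F in
  (s : ℕ) (h q : Carrier) → h # 0# → (q#0 : q # 0#) (q#1? : Dec (q # 1#)) →
  let open NormalOrdering F s h q using (IsNormalOrdering)
      q^ : ℤ → Carrier
      q^ = zpow q q#0
      [_] : ℤ → Carrier
      [_] = qNumber q q#0 q#1?
      s-1 : ℤ
      s-1 = + s -ᶻ 1ℤ
  in
  (S : ℕ → ℕ → Carrier) → IsNormalOrdering S →
  (∀ n k → 1 ≤ k → k ≤ n →
    S n k ≈ ∑[ j ∈ k ⋯ n ]
      (h ^ (n ∸ j)
        * q^ (+ s *ᶻ (+ j -ᶻ 1ℤ) -ᶻ s-1 *ᶻ (+ k -ᶻ 1ℤ))
        * S (j ∸ 1) (k ∸ 1)
        * (∏[ i ∈ j ⋯ n ∸ 1 ] [ + s *ᶻ + i -ᶻ s-1 *ᶻ + k ])))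
  ×
  (∀ n k → k ≤ n →
    S n k ≈ ∑[ j ∈ k ⋯ n ]
      ((- h) ^ (j ∸ k)
        * q^ (+ s *ᶻ + n *ᶻ (+ k -ᶻ + j -ᶻ 1ℤ) +ᶻ s-1 *ᶻ + (suc j C 2) -ᶻ s-1 *ᶻ + (k C 2))
        * S (suc n) (suc j)
        * (∏[ i ∈ suc k ⋯ j ] [ + s *ᶻ + n -ᶻ s-1 *ᶻ + i ])))
  ×
  (∀ n k → k < n →
    S n k ≈ ∑[ j ∈ 0 ⋯ k ]
      (h
        * q^ (+ j *ᶻ (+ s *ᶻ + n -ᶻ s-1 *ᶻ + k) -ᶻ + (suc j C 2))
        * [ + s *ᶻ (+ n -ᶻ + j -ᶻ 1ℤ) -ᶻ s-1 *ᶻ (+ k -ᶻ + j) ]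
        * S (n ∸ j ∸ 1) (k ∸ j)))
corollary6 F s h q _ q#0 q#1? S expansion =
  -- The bounds force both indices to be successors, so `n ∸ 1` and `k ∸ 1` compute.
  (λ { (suc n) (suc k) _ (s≤s k≤n) → column-expansion n k k≤n }) ,
  row-expansion ,
  diagonal-expansion
  where open Identities F s h q q#0 q#1? S expansion
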